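{- Let $G$ be a finite graph such that $m(G)=2^k$ for some integer $k\geq 1$. Then $p(G)=k+1$ if and only if $|{\rm Iso}(G)|=2^k$ or $|{\rm Iso}(\overline{G})|=2^k$. (Otherwise $p(G)=k$.)
   Context: Graphs are finite, simple and undirected; $G[W]$ is the induced subgraph on $W$, and $\overline{G}$ is the complement of $G$. ${\rm Iso}(G)$ is the set of isolated vertices of $G$ (vertices with no neighbour). A subset $M\subseteq V(G)$ is a module of $G$ if every vertex outside $M$ is adjacent to all elements of $M$ or to none. The modules $\emptyset$, $V(G)$, $\{v\}$ are trivial. $G$ is prime if $|V(G)|\geq 4$ and all its modules are trivial. An extension of $G$ is a graph $H$ with $V(H)\supseteq V(G)$ and $H[V(G)]=G$; a $p$-extension additionally has $|V(H)\setminus V(G)|=p$. The prime bound $p(G)$ is the least $p$ such that $G$ admits a prime $p$-extension. $\omega_M(G)$ (resp. $\alpha_M(G)$) is the largest size of a module of $G$ that is a clique (resp. a stable set) in $G$, and $m(G)=\max(\alpha_M(G),\omega_M(G))$. (It is known that for $m(G)=2^k$, $k\ge 1$, one has $p(G)\in\{k,k+1\}$.) -}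

module Defs where

open import Data.Nat using (ℕ; _+_; _≤_; _<_; _⊔_)
open import Data.Bool using (Bool; true; false; not; if_then_else_)
open import Data.Fin using (Fin; _↑ˡ_; _≟_)
open import Data.Fin.Subset using (Subset; _∈_; _∉_; ∣_∣; ⁅_⁆) renaming (⊥ to ∅; ⊤ to full)
open import Data.Product using (Σ; ∃; _×_; _,_)
open import Data.Sum using (_⊎_)
open import Relation.Nullary using (¬_; ⌊_⌋)
open import Relation.Binary.PropositionalEquality using (_≡_; _≢_)

record Graph (n : ℕ) : Set where
  field
    adj    : Fin n → Fin n → Bool
    sym    : ∀ x y → adj x y ≡ adj y x
    irrefl : ∀ x → adj x x ≡ false
open Graph public

complement : ∀ {n} → Graph n → Graph n
complement {n} G = record { adj = a ; sym = s ; irrefl = i }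
  where
  a : Fin n → Fin n → Bool
  a x y = if ⌊ x ≟ y ⌋ then false else not (adj G x y)
  s : ∀ x y → a x y ≡ a y x
  s x y with x ≟ y | y ≟ x
  ... | Relation.Nullary.yes _ | Relation.Nullary.yes _ = _≡_.refl
  ... | Relation.Nullary.yes p | Relation.Nullary.no q = Data.Empty.⊥-elim (q (Relation.Binary.PropositionalEquality.sym p))
    where import Data.Empty
  ... | Relation.Nullary.no q | Relation.Nullary.yes p = Data.Empty.⊥-elim (q (Relation.Binary.PropositionalEquality.sym p))
    where import Data.Empty
  ... | Relation.Nullary.no _ | Relation.Nullary.no _ = Relation.Binary.PropositionalEquality.cong not (sym G x y)
  i : ∀ x → a x x ≡ false
  i x with x ≟ x
  ... | Relation.Nullary.yes _ = _≡_.refl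
  ... | Relation.Nullary.no q = Data.Empty.⊥-elim (q _≡_.refl)
    where import Data.Empty

Isolated : ∀ {n} → Graph n → Fin n → Set
Isolated G v = ∀ w → adj G v w ≡ false

IsoSize : ∀ {n} → Graph n → ℕ → Set
IsoSize {n} G s = Σ (Subset n) λ S → (∀ v → (v ∈ S → Isolated G v) × (Isolated G v → v ∈ S)) × ∣ S ∣ ≡ s

IsModule : ∀ {n} → Graph n → Subset n → Set
IsModule G M = ∀ x → x ∉ M →
  (∀ y → y ∈ M → adj G x y ≡ true) ⊎ (∀ y → y ∈ M → adj G x y ≡ false)

IsTrivial : ∀ {n} → Subset n → Set
IsTrivial M = M ≡ ∅ ⊎ M ≡ full ⊎ ∃ λ v → M ≡ ⁅ v ⁆

IsPrime : ∀ {n} → Graph n → Set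
IsPrime {n} G = 4 ≤ n × (∀ M → IsModule G M → IsTrivial M)

IsExtension : ∀ {n} (p : ℕ) → Graph n → Graph (n + p) → Set
IsExtension {n} p G H = ∀ x y → adj H (x ↑ˡ p) (y ↑ˡ p) ≡ adj G x y

HasPrimeExtension : ∀ {n} → Graph n → ℕ → Set
HasPrimeExtension {n} G p = Σ (Graph (n + p)) λ H → IsExtension p G H × IsPrime H

PrimeBound : ∀ {n} → Graph n → ℕ → Set
PrimeBound G p = HasPrimeExtension G p × (∀ q → q < p → ¬ HasPrimeExtension G q)

IsClique : ∀ {n} → Graph n → Subset n → Set
IsClique G M = ∀ x y → x ∈ M → y ∈ M → x ≢ y → adj G x y ≡ true

IsStable : ∀ {n} → Graph n → Subset n → Set
IsStable G M = ∀ x y → x ∈ M → y ∈ M → adj G x y ≡ false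

IsMaxSize : ∀ {n} → (Subset n → Set) → ℕ → Set
IsMaxSize {n} P s = (Σ (Subset n) λ M → P M × ∣ M ∣ ≡ s) × (∀ M → P M → ∣ M ∣ ≤ s)

OmegaM : ∀ {n} → Graph n → ℕ → Set
OmegaM G w = IsMaxSize (λ M → IsModule G M × IsClique G M) w

AlphaM : ∀ {n} → Graph n → ℕ → Set
AlphaM G a = IsMaxSize (λ M → IsModule G M × IsStable G M) a

MG : ∀ {n} → Graph n → ℕ → Set
MG G m = Σ ℕ λ a → Σ ℕ λ w → AlphaM G a × OmegaM G w × a ⊔ w ≡ m

{-# OPTIONS --safe #-}
module Submission where

-- Lower bounds: twins of G must have distinct traces on the new vertices, and
-- an isolated vertex of G cannot have the empty trace.
--
-- Upper bound: after complementing if necessary, let c lie in a stable module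
-- with 2^k elements, and add a stable set of k vertices.  Identify the trace of
-- x with the set of new vertices that see x as c does.  The elements of a twin
-- class get distinct traces (its members are ranked and ranks written in
-- binary, so that the full trace occurs only in classes of size 2^k), and one
-- vertex of each minimal module without twins also gets the full trace, its
-- other vertices do not.  Then no module of G has constant trace.  A module of
-- the extension with at least two elements that meets both parts contains all
-- the new vertices, and every old vertex b outside it has full trace; this
-- forces b to have 2^k twins and to be isolated or universal.
--
-- If G has 2^k isolated vertices, adding a universal vertex to G first costs
-- one more vertex and leads back to the previous situation.

open import Defs
open import Data.Bool using (Bool; true; false; not; if_then_else_)
import Data.Bool as Bool
open import Data.Bool.Properties using (not-¬; ¬-not; not-involutive)
open import Data.Empty using (⊥; ⊥-elim)
open import Data.Fin using (Fin; zero; suc; toℕ; fromℕ<; combine; funToFin; finToFun; splitAt; join; _↑ˡ_; _↑ʳ_)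
import Data.Fin as Fin
open import Data.Fin.Properties using (all?; any?; _≟_; toℕ<n; toℕ-fromℕ<; fromℕ<-injective; toℕ-injective;
  toℕ-combine; funToFin-finToFin; finToFun-funToFin; ≤-antisym; splitAt-↑ˡ; splitAt-join; join-splitAt; ↑ˡ-injective;
  injective⇒≤; pigeonhole)
open import Data.Fin.Subset using (Subset; _∈_; _∉_; _⊆_; ∣_∣; ∁; ⁅_⁆)
open import Data.Fin.Subset.Properties using (_∈?_; _⊆?_; p⊂q⇒∣p∣<∣q∣; p⊆q⇒∣p∣≤∣q∣; anySubset?; nonempty?;
  Empty-unique; ∉⊥; ∈⊤; ⊆-antisym; x∈⁅x⁆; x∈⁅y⁆⇒x≡y; ∣⁅x⁆∣≡1; ∣⊥∣≡0;
  ∣∁p∣≡n∸∣p∣; ∣p∣≤n; ∣p∣≡n⇒p≡⊤; x∉∁p⇒x∈p; x∈∁p⇒x∉p)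
open import Data.Nat using (ℕ; zero; suc; _+_; _*_; _∸_; _^_; _≤_; _<_; z≤n; s≤s)
import Data.Nat.Properties as ℕ
open import Data.Nat.Induction using (<-wellFounded)
open import Data.Product using (∃; ∃₂; _×_; _,_; proj₁; proj₂)
open import Data.Sum using (_⊎_; inj₁; inj₂)
open import Data.Vec using ([]; _∷_; tabulate; here; there)
open import Data.Vec.Properties using (lookup⇒[]=; []=⇒lookup; lookup∘tabulate; tabulate-cong)
open import Function using (_∘_)
open import Function.Bundles using (_⇔_; mk⇔)
open import Induction.WellFounded using (Acc; acc)
open import Relation.Nullary using (¬_; Dec; yes; no; does; contradiction)
open import Relation.Nullary.Decidable using (decidable-stable; ¬?; _×-dec_; _→-dec_; _⊎-dec_; dec-true; dec-false; does-⇔)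
open import Relation.Unary using (Decidable)
open import Relation.Binary.PropositionalEquality using (_≡_; _≢_; refl; trans; cong; cong₂; subst; subst₂; ≢-sym)
import Relation.Binary.PropositionalEquality as ≡

-- Finite subsets: filtering, ranks, pairs of distinct elements.

filter : ∀ {n} {P : Fin n → Set} → Decidable P → Subset n
filter P? = tabulate (λ x → does (P? x))

module _ {n} {P : Fin n → Set} (P? : Decidable P) where

  ∈-filter⁺ : ∀ {x} → P x → x ∈ filter P?
  ∈-filter⁺ {x} p = lookup⇒[]= x _ (trans (lookup∘tabulate _ x) (dec-true (P? x) p))

  ∈-filter⁻ : ∀ {x} → x ∈ filter P? → P x
  ∈-filter⁻ {x} x∈ with P? x | trans (≡.sym (lookup∘tabulate (λ y → does (P? y)) x)) ([]=⇒lookup x∈)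
  ... | yes p | _ = p
  ... | no _ | ()

rank : ∀ {n} → Subset n → Fin n → ℕ
rank (_ ∷ S) zero = 0
rank (true ∷ S) (suc x) = suc (rank S x)
rank (false ∷ S) (suc x) = rank S x

rank<∣∣ : ∀ {n} (S : Subset n) {x} → x ∈ S → rank S x < ∣ S ∣
rank<∣∣ (true ∷ S) here = s≤s z≤n
rank<∣∣ (true ∷ S) (there x∈S) = s≤s (rank<∣∣ S x∈S)
rank<∣∣ (false ∷ S) (there x∈S) = rank<∣∣ S x∈S

rank-injective : ∀ {n} (S : Subset n) {x y} → x ∈ S → y ∈ S → rank S x ≡ rank S y → x ≡ y
rank-injective (true ∷ S) here here eq = refl
rank-injective (true ∷ S) (there x∈S) (there y∈S) eq = cong suc (rank-injective S x∈S y∈S (ℕ.suc-injective eq))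
rank-injective (false ∷ S) (there x∈S) (there y∈S) eq = cong suc (rank-injective S x∈S y∈S eq)

rank-surjective : ∀ {n} (S : Subset n) {r} → r < ∣ S ∣ → ∃ λ x → x ∈ S × rank S x ≡ r
rank-surjective (true ∷ S) {zero} _ = zero , here , refl
rank-surjective (true ∷ S) {suc r} (s≤s r<) with x , x∈S , eq ← rank-surjective S r< = suc x , there x∈S , cong suc eq
rank-surjective (false ∷ S) r< with x , x∈S , eq ← rank-surjective S r< = suc x , there x∈S , eq

least : ∀ {n} (S : Subset n) {x} → x ∈ S → ∃ λ m → m ∈ S × (∀ y → y ∈ S → m Fin.≤ y)
least (true ∷ S) _ = zero , here , λ _ _ → z≤n
least (false ∷ S) (there x∈S) with m , m∈S , m≤ ← least S x∈S =
  suc m , there m∈S , λ { (suc y) (there y∈S) → s≤s (m≤ y y∈S) }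

Pair : ∀ {n} → Subset n → Set
Pair S = ∃₂ λ x y → x ∈ S × y ∈ S × x ≢ y

pair? : ∀ {n} → Decidable (Pair {n})
pair? S = any? λ x → any? λ y → x ∈? S ×-dec y ∈? S ×-dec ¬? (x ≟ y)

2≤∣∣⇒Pair : ∀ {n} (S : Subset n) → 2 ≤ ∣ S ∣ → Pair S
2≤∣∣⇒Pair S 2≤ with x , x∈ , rx ← rank-surjective S (ℕ.<-trans (s≤s z≤n) 2≤) | y , y∈ , ry ← rank-surjective S 2≤ =
  x , y , x∈ , y∈ , λ { refl → contradiction (trans (≡.sym rx) ry) λ () }

other : ∀ {n} {S : Subset n} → Pair S → ∀ x → ∃ λ y → y ∈ S × y ≢ x
other (a , b , a∈ , b∈ , a≢b) x with a ≟ x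
... | yes refl = b , b∈ , ≢-sym a≢b
... | no a≢x = a , a∈ , a≢x

-- Binary words of length `k` as elements of `Fin (2 ^ k)`.

bitOf : Fin 2 → Bool
bitOf zero = false
bitOf (suc _) = true

ofBit : Bool → Fin 2
ofBit false = zero
ofBit true = suc zero

bitOf-ofBit : ∀ b → bitOf (ofBit b) ≡ b
bitOf-ofBit false = refl
bitOf-ofBit true = refl

bitOf-injective : ∀ {i j} → bitOf i ≡ bitOf j → i ≡ j
bitOf-injective {zero} {zero} _ = refl
bitOf-injective {suc zero} {suc zero} _ = refl

bits : ∀ k → Fin (2 ^ k) → Fin k → Bool
bits k i = bitOf ∘ finToFun {2} {k} i

fromBits : ∀ k → (Fin k → Bool) → Fin (2 ^ k)
fromBits k φ = funToFin (ofBit ∘ φ)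

bits-fromBits : ∀ k (φ : Fin k → Bool) s → bits k (fromBits k φ) s ≡ φ s
bits-fromBits k φ s = trans (cong bitOf (finToFun-funToFin (ofBit ∘ φ) s)) (bitOf-ofBit (φ s))

funToFin-cong : ∀ {m n} {f g : Fin m → Fin n} → (∀ i → f i ≡ g i) → funToFin f ≡ funToFin g
funToFin-cong {zero} _ = refl
funToFin-cong {suc m} eq = cong₂ combine (eq zero) (funToFin-cong (eq ∘ suc))

bits-injective : ∀ k {i j : Fin (2 ^ k)} → (∀ s → bits k i s ≡ bits k j s) → i ≡ j
bits-injective k {i} {j} eq = trans (≡.sym (funToFin-finToFin {k} i))
  (trans (funToFin-cong {k} (bitOf-injective ∘ eq)) (funToFin-finToFin {k} j))

-- The word of ones is the largest number below `2 ^ k`; as a rank of an element it occurs only in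
-- sets with at least `2 ^ k` elements.
toℕ-fromBits-true : ∀ k → suc (toℕ (fromBits k (λ _ → true))) ≡ 2 ^ k
toℕ-fromBits-true zero = refl
toℕ-fromBits-true (suc k) = begin
  suc (toℕ (combine {2} (suc zero) last))  ≡⟨ cong suc (toℕ-combine {2} (suc zero) last) ⟩
  suc (2 ^ k * 1 + toℕ last)               ≡⟨ ≡.sym (ℕ.+-suc (2 ^ k * 1) _) ⟩
  2 ^ k * 1 + suc (toℕ last)               ≡⟨ cong₂ _+_ (ℕ.*-identityʳ (2 ^ k))
                                              (trans (toℕ-fromBits-true k) (≡.sym (ℕ.+-identityʳ _))) ⟩
  2 ^ suc k                                ∎
  where
  open ≡.≡-Reasoning
  last = fromBits k (λ _ → true)

-- Twin classes, minimal modules and atoms.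

module Twins {n} (G : Graph n) where

  Twin : Fin n → Fin n → Set
  Twin x y = ∀ z → z ≢ x → z ≢ y → adj G z x ≡ adj G z y

  -- The decision procedures entering the traces are abstract because otherwise
  -- every 'with' over a goal that mentions a trace would normalise them.
  abstract
    twin? : ∀ x y → Dec (Twin x y)
    twin? x y = all? λ z → ¬? (z ≟ x) →-dec ¬? (z ≟ y) →-dec adj G z x Bool.≟ adj G z y

  twin-refl : ∀ {x} → Twin x x
  twin-refl z _ _ = refl

  twin-sym : ∀ {x y} → Twin x y → Twin y x
  twin-sym t z z≢y z≢x = ≡.sym (t z z≢x z≢y)

  twin-trans : ∀ {x y z} → Twin x y → Twin y z → Twin x z
  twin-trans {x} {y} {z} t u w w≢x w≢z with w ≟ y | x ≟ z
  ... | no w≢y | _ = trans (t w w≢x w≢y) (u w w≢y w≢z)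
  ... | yes refl | yes refl = refl
  -- At the middle vertex neither hypothesis applies directly; the detour over the pair `x`, `z`
  -- uses `u` at `x` and `t` at `z`.
  ... | yes refl | no x≢z =
    trans (sym G y x) (trans (u x (≢-sym w≢x) x≢z) (trans (sym G x z) (trans (t z (≢-sym x≢z) (≢-sym w≢z)) (sym G z y))))

  class : Fin n → Subset n
  class x = filter (twin? x)

  ∈-class⁺ : ∀ {x y} → Twin x y → y ∈ class x
  ∈-class⁺ {x} = ∈-filter⁺ (twin? x)

  ∈-class⁻ : ∀ {x y} → y ∈ class x → Twin x y
  ∈-class⁻ {x} = ∈-filter⁻ (twin? x)

  -- Equality of the subsets themselves makes ranks of twins comparable, since both are then ranks
  -- in one set.
  class-cong : ∀ {x y} → Twin x y → class x ≡ class y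
  class-cong {x} {y} t = tabulate-cong λ z →
    does-⇔ (mk⇔ (twin-trans (twin-sym t)) (twin-trans t)) (twin? x z) (twin? y z)

  -- `IsModule` with the choice between all and none replaced by agreement on pairs.
  Homogeneous : Subset n → Set
  Homogeneous A = ∀ z → z ∉ A → ∀ x y → x ∈ A → y ∈ A → adj G z x ≡ adj G z y

  homogeneous? : Decidable Homogeneous
  homogeneous? A = all? λ z → ¬? (z ∈? A) →-dec all? λ x → all? λ y →
    x ∈? A →-dec y ∈? A →-dec adj G z x Bool.≟ adj G z y

  class-homogeneous : ∀ x → Homogeneous (class x)
  class-homogeneous x z z∉ y y' y∈ y'∈ =
    twin-trans (twin-sym (∈-class⁻ y∈)) (∈-class⁻ y'∈) z (λ { refl → z∉ y∈ }) (λ { refl → z∉ y'∈ })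

  Refines : Subset n → Subset n → Set
  Refines A B = Homogeneous B × B ⊆ A × Pair B × ¬ A ⊆ B

  Minimal : Subset n → Set
  Minimal A = ¬ ∃ (Refines A)

  refinement? : ∀ A → Dec (∃ (Refines A))
  refinement? A = anySubset? λ B → homogeneous? B ×-dec B ⊆? A ×-dec pair? B ×-dec ¬? (A ⊆? B)

  minimal? : Decidable Minimal
  minimal? A = ¬? (refinement? A)

  ⊈⇒∃ : ∀ {A B : Subset n} → ¬ A ⊆ B → ∃ λ x → x ∈ A × x ∉ B
  ⊈⇒∃ {A} {B} A⊈B with any? (λ x → x ∈? A ×-dec ¬? (x ∈? B))
  ... | yes p = p
  ... | no ¬p = contradiction (λ {x} x∈A → decidable-stable (x ∈? B) λ x∉B → ¬p (x , x∈A , x∉B)) A⊈B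

  minimal-below : ∀ A → Homogeneous A → Pair A → ∃ λ B → B ⊆ A × Homogeneous B × Pair B × Minimal B
  minimal-below A = go A (<-wellFounded ∣ A ∣)
    where
    go : ∀ A → Acc _<_ ∣ A ∣ → Homogeneous A → Pair A → ∃ λ B → B ⊆ A × Homogeneous B × Pair B × Minimal B
    go A (acc rec) hA pA with minimal? A
    ... | yes min = A , (λ x∈ → x∈) , hA , pA , min
    ... | no ¬min with B , hB , B⊆A , pB , A⊈B ← decidable-stable (refinement? A) ¬min
      with C , C⊆B , r ← go B (rec (p⊂q⇒∣p∣<∣q∣ (B⊆A , ⊈⇒∃ A⊈B))) hB pB = C , (λ x∈ → B⊆A (C⊆B x∈)) , r

  TwinFree : Subset n → Set
  TwinFree A = ∀ x y → x ∈ A → y ∈ A → Twin x y → x ≡ y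

  twinFree? : Decidable TwinFree
  twinFree? A = all? λ x → all? λ y → x ∈? A →-dec y ∈? A →-dec twin? x y →-dec x ≟ y

  -- Equivalently, A is a module that induces a prime subgraph.
  Atom : Subset n → Set
  Atom A = Homogeneous A × Pair A × Minimal A × TwinFree A

  atom? : Decidable Atom
  atom? A = homogeneous? A ×-dec pair? A ×-dec minimal? A ×-dec twinFree? A

  module _ {A : Subset n} (atom : Atom A) where

    private
      hA : Homogeneous A
      hA = proj₁ atom

      pA : Pair A
      pA = proj₁ (proj₂ atom)

      mA : Minimal A
      mA = proj₁ (proj₂ (proj₂ atom))

      tA : TwinFree A
      tA = proj₂ (proj₂ (proj₂ atom))

    -- Otherwise `A` without `x` is a module, so by minimality it is a single vertex `w`; then `x`
    -- and `w` are twins, which an atom excludes.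
    atom-indecomposable : ∀ {x} → x ∈ A → ¬ (∀ y z → y ∈ A → z ∈ A → y ≢ x → z ≢ x → adj G x y ≡ adj G x z)
    atom-indecomposable {x} x∈A const with w , w∈A , w≢x ← other pA x =
      w≢x (≡.sym (tA x w x∈A w∈A twin))
      where
      B? : Decidable (λ y → y ∈ A × y ≢ x)
      B? y = y ∈? A ×-dec ¬? (y ≟ x)
      hB : Homogeneous (filter B?)
      hB z z∉B y y' y∈B y'∈B with y∈A , y≢x ← ∈-filter⁻ B? y∈B | y'∈A , y'≢x ← ∈-filter⁻ B? y'∈B | z ∈? A | z ≟ x
      ... | no z∉A | _ = hA z z∉A y y' y∈A y'∈A
      ... | yes _ | yes refl = const y y' y∈A y'∈A y≢x y'≢x
      ... | yes z∈A | no z≢x = contradiction (∈-filter⁺ B? (z∈A , z≢x)) z∉B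
      only : ∀ y → y ∈ A → y ≢ x → y ≡ w
      only y y∈A y≢x = decidable-stable (y ≟ w) λ y≢w → mA (filter B? , hB , (λ z∈ → proj₁ (∈-filter⁻ B? z∈)) ,
        (y , w , ∈-filter⁺ B? (y∈A , y≢x) , ∈-filter⁺ B? (w∈A , w≢x) , y≢w) , λ A⊆B → proj₂ (∈-filter⁻ B? (A⊆B x∈A)) refl)
      twin : Twin x w
      twin v v≢x v≢w = hA v (λ v∈A → v≢w (only v v∈A v≢x)) x w x∈A w∈A

    -- A twin `y` outside `A` sees all of `A` alike, hence `x` would see the rest of `A` alike.
    atom-twin : ∀ {x y} → x ∈ A → Twin x y → x ≡ y
    atom-twin {x} {y} x∈A t with y ∈? A
    ... | yes y∈A = tA x y x∈A y∈A t
    ... | no y∉A = ⊥-elim (atom-indecomposable x∈A λ v w v∈A w∈A v≢x w≢x →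
      trans (through v∈A v≢x) (trans (hA y y∉A v w v∈A w∈A) (≡.sym (through w∈A w≢x))))
      where
      through : ∀ {v} → v ∈ A → v ≢ x → adj G x v ≡ adj G y v
      through {v} v∈A v≢x = trans (sym G x v) (trans (t v v≢x λ { refl → y∉A v∈A }) (sym G v y))

    -- The intersection of `A` and `B` is a module missing `w`, so by minimality it is just `x`. The
    -- rest of `A` lies outside `B` and does not distinguish `x` from `z`, while `z`, outside `A`,
    -- sees all of `A` alike.
    atom-overlap : ∀ {B x z w} → Homogeneous B → x ∈ A → x ∈ B → z ∈ B → z ∉ A → w ∈ A → w ∉ B → ⊥
    atom-overlap {B} {x} {z} {w} hB x∈A x∈B z∈B z∉A w∈A w∉B = atom-indecomposable x∈A λ u v u∈A v∈A u≢x v≢x →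
      trans (through u∈A u≢x) (trans (hA z z∉A u v u∈A v∈A) (≡.sym (through v∈A v≢x)))
      where
      C? : Decidable (λ y → y ∈ A × y ∈ B)
      C? y = y ∈? A ×-dec y ∈? B
      hC : Homogeneous (filter C?)
      hC v v∉C y y' y∈C y'∈C with y∈A , y∈B ← ∈-filter⁻ C? y∈C | y'∈A , y'∈B ← ∈-filter⁻ C? y'∈C | v ∈? A | v ∈? B
      ... | no v∉A | _ = hA v v∉A y y' y∈A y'∈A
      ... | yes _ | no v∉B = hB v v∉B y y' y∈B y'∈B
      ... | yes v∈A | yes v∈B = contradiction (∈-filter⁺ C? (v∈A , v∈B)) v∉C
      only : ∀ {y} → y ∈ A → y ∈ B → y ≡ x
      only {y} y∈A y∈B = decidable-stable (y ≟ x) λ y≢x → mA (filter C? , hC , (λ v∈ → proj₁ (∈-filter⁻ C? v∈)) ,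
        (y , x , ∈-filter⁺ C? (y∈A , y∈B) , ∈-filter⁺ C? (x∈A , x∈B) , y≢x) , λ A⊆C → w∉B (proj₂ (∈-filter⁻ C? (A⊆C w∈A))))
      through : ∀ {v} → v ∈ A → v ≢ x → adj G x v ≡ adj G z v
      through {v} v∈A v≢x = trans (sym G x v) (trans (hB v (λ v∈B → v≢x (only v∈A v∈B)) x z x∈B z∈B) (sym G v z))

  -- If `w` were in `A` but not in `B`, the absence of proper overlaps would put `B` strictly inside
  -- `A`, against minimality. By symmetry, atoms that meet coincide.
  atom-meet : ∀ {A B x} → Atom A → Atom B → x ∈ A → x ∈ B → A ⊆ B
  atom-meet {A} {B} aA@(_ , _ , mA , _) (hB , pB , _) x∈A x∈B {w} w∈A = decidable-stable (w ∈? B) λ w∉B →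
    mA (B , hB , (λ {z} z∈B → decidable-stable (z ∈? A) λ z∉A → atom-overlap aA hB x∈A x∈B z∈B z∉A w∈A w∉B) ,
        pB , λ A⊆B → w∉B (A⊆B w∈A))

  -- Taking the least vertex selects exactly one representative of each atom; it will carry the full
  -- trace.
  Special : Fin n → Set
  Special x = ∃ λ A → Atom A × x ∈ A × (∀ y → y ∈ A → x Fin.≤ y)

  abstract
    special? : Decidable Special
    special? x = anySubset? λ A → atom? A ×-dec x ∈? A ×-dec all? λ y → y ∈? A →-dec x Fin.≤? y

  special-twin : ∀ {x y} → Special x → Twin x y → x ≡ y
  special-twin (A , aA , x∈A , _) = atom-twin aA x∈A

  special-unique : ∀ {A x y} → Atom A → x ∈ A → y ∈ A → Special x → Special y → x ≡ y
  special-unique aA x∈A y∈A (B , aB , x∈B , x≤) (C , aC , y∈C , y≤) =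
    ≤-antisym (x≤ _ (atom-meet aA aB x∈A x∈B y∈A)) (y≤ _ (atom-meet aA aC y∈A y∈C x∈A))

  atom-special : ∀ {A} → Atom A → ∃ λ x → x ∈ A × Special x
  atom-special {A} aA@(_ , (_ , _ , y∈A , _) , _) with m , m∈A , m≤ ← least A y∈A = m , m∈A , A , aA , m∈A , m≤

  -- Either `b` is isolated (`β` false) or it is universal (`β` true).
  Dominated : Fin n → Set
  Dominated b = ∃ λ β → ∀ y → y ≢ b → adj G b y ≡ β

-- Modules as Boolean predicates on any vertex type, so that the extension can live on a disjoint
-- sum without index arithmetic.
IsModuleOn : ∀ {V : Set} → (V → V → Bool) → (V → Bool) → Set
IsModuleOn e P = ∀ z → P z ≡ false → ∀ x y → P x ≡ true → P y ≡ true → e z x ≡ e z y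

PrimeOn : ∀ {V : Set} → (V → V → Bool) → Set
PrimeOn e = ∀ P → IsModuleOn e P → ∀ x y → P x ≡ true → P y ≡ true → x ≢ y → ∀ z → P z ≡ true

-- The extension by a stable set of `k` vertices and its primeness.

module Construction {n} (G : Graph n) (k : ℕ) (1≤k : 1 ≤ k) (c : Fin n)
  (cap : ∀ x → ∣ Twins.class G x ∣ ≤ 2 ^ k) (full : ∣ Twins.class G c ∣ ≡ 2 ^ k)
  (stable : ∀ y → Twins.Twin G c y → adj G y c ≡ false)
  (undominated : ∀ b → ∣ Twins.class G b ∣ ≡ 2 ^ k → ¬ Twins.Dominated G b) where
  open Twins G

  Full : Fin n → Set
  Full x = ∣ class x ∣ ≡ 2 ^ k

  2≤2^k : 2 ≤ 2 ^ k
  2≤2^k = ℕ.^-monoʳ-≤ 2 1≤k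

  abstract
    full-twin : ∀ {x} → Full x → ∃ λ y → Twin x y × y ≢ x
    full-twin {x} fx with y , y∈ , y≢x ← other (2≤∣∣⇒Pair (class x) (subst (2 ≤_) (≡.sym fx) 2≤2^k)) x =
      y , ∈-class⁻ y∈ , y≢x

  index< : ∀ x → rank (class x) x < 2 ^ k
  index< x = ℕ.<-≤-trans (rank<∣∣ (class x) (∈-class⁺ twin-refl)) (cap x)

  index : Fin n → Fin (2 ^ k)
  index x = fromℕ< (index< x)

  -- A special vertex has no other twin, so overriding its binary trace creates no collision inside
  -- a twin class.
  same : Fin n → Fin k → Bool
  same x s = if does (special? x) then true else bits k (index x) s

  -- Every new vertex is a perturbed copy of c: it sees x as c does exactly when same x s.
  link : Fin n → Fin k → Bool
  link x s = if same x s then adj G x c else not (adj G x c)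

  edge : Fin n ⊎ Fin k → Fin n ⊎ Fin k → Bool
  edge (inj₁ x) (inj₁ y) = adj G x y
  edge (inj₁ x) (inj₂ s) = link x s
  edge (inj₂ s) (inj₁ x) = link x s
  edge (inj₂ s) (inj₂ t) = false

  edge-sym : ∀ u v → edge u v ≡ edge v u
  edge-sym (inj₁ x) (inj₁ y) = sym G x y
  edge-sym (inj₁ x) (inj₂ s) = refl
  edge-sym (inj₂ s) (inj₁ x) = refl
  edge-sym (inj₂ s) (inj₂ t) = refl

  edge-irrefl : ∀ u → edge u u ≡ false
  edge-irrefl (inj₁ x) = irrefl G x
  edge-irrefl (inj₂ s) = refl

  same-ordinary : ∀ {x} → ¬ Special x → ∀ s → same x s ≡ bits k (index x) s
  same-ordinary {x} ¬sp s rewrite dec-false (special? x) ¬sp = refl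

  same-special : ∀ {x} → Special x → ∀ s → same x s ≡ true
  same-special {x} sp s rewrite dec-true (special? x) sp = refl

  -- An ordinary vertex with the full trace has rank `2 ^ k - 1` in its class, so the class reaches
  -- the maximal size.
  same-true : ∀ {x} → (∀ s → same x s ≡ true) → Special x ⊎ Full x
  same-true {x} all with special? x
  ... | yes sp = inj₁ sp
  ... | no ¬sp = inj₂ (ℕ.≤-antisym (cap x) (begin
    2 ^ k                                   ≡⟨ ≡.sym (toℕ-fromBits-true k) ⟩
    suc (toℕ (fromBits k λ _ → true))     ≡⟨ cong (suc ∘ toℕ) (≡.sym (bits-injective k λ s →
      trans (all s) (≡.sym (bits-fromBits k (λ _ → true) s)))) ⟩
    suc (toℕ (index x))                     ≡⟨ cong suc (toℕ-fromℕ< (index< x)) ⟩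
    suc (rank (class x) x)                  ≤⟨ rank<∣∣ (class x) (∈-class⁺ twin-refl) ⟩
    ∣ class x ∣                             ∎))
    where open ℕ.≤-Reasoning

  same-injective : ∀ {x y} → Twin x y → (∀ s → same x s ≡ same y s) → x ≡ y
  same-injective {x} {y} t eq with special? x | special? y
  ... | yes sp | _ = special-twin sp t
  ... | no _ | yes sp = ≡.sym (special-twin sp (twin-sym t))
  ... | no ¬sp | no ¬sp' = rank-injective (class x) (∈-class⁺ twin-refl) (∈-class⁺ t)
    (trans (fromℕ<-injective _ _ (index< x) (index< y) (bits-injective k eq))
           (cong (λ S → rank S y) (≡.sym (class-cong t))))

  abstract
    -- The class of `c` has exactly `2 ^ k` members, so every word is the rank of one of them. Each
    -- has a further twin, hence none is special and its trace is its rank.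
    same-surjective : ∀ (φ : Fin k → Bool) → ∃ λ x → Twin c x × (∀ s → same x s ≡ φ s)
    same-surjective φ with x , x∈ , eq ← rank-surjective (class c) (subst (toℕ (fromBits k φ) <_) (≡.sym full) (toℕ<n (fromBits k φ))) =
      x , t , λ s → trans (same-ordinary ¬sp s) (trans (cong (λ i → bits k i s) index≡) (bits-fromBits k φ s))
      where
      t : Twin c x
      t = ∈-class⁻ x∈
      ¬sp : ¬ Special x
      ¬sp sp with y , u , y≢c ← full-twin full =
        y≢c (trans (≡.sym (special-twin sp (twin-trans (twin-sym t) u))) (special-twin sp (twin-sym t)))
      index≡ : index x ≡ fromBits k φ
      index≡ = toℕ-injective (trans (toℕ-fromℕ< (index< x)) (trans (cong (λ S → rank S x) (≡.sym (class-cong t))) eq))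

  link-same : ∀ {x} s → same x s ≡ true → link x s ≡ adj G x c
  link-same s eq rewrite eq = refl

  link-flip : ∀ {x} s → same x s ≡ false → link x s ≡ not (adj G x c)
  link-flip s eq rewrite eq = refl

  same-of-link : ∀ {x} s → link x s ≡ adj G x c → same x s ≡ true
  same-of-link {x} s eq with same x s
  ... | true = refl
  ... | false = contradiction (≡.sym eq) (not-¬ refl)

  link-cancel : ∀ {x y s t} → adj G x c ≡ adj G y c → link x s ≡ link y t → same x s ≡ same y t
  link-cancel {x} {y} {s} {t} a≡ eq with same x s | same y t
  ... | true | true = refl
  ... | false | false = refl
  ... | true | false = contradiction (trans (≡.sym a≡) eq) (not-¬ refl)
  ... | false | true = contradiction (≡.sym (trans eq (≡.sym a≡))) (not-¬ refl)

  -- Being twins says nothing when `c` is itself `x` or `y`; there the stability of its class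
  -- supplies the value false.
  twin-adj-c : ∀ {x y} → Twin x y → adj G x c ≡ adj G y c
  twin-adj-c {x} {y} t with c ≟ x | c ≟ y
  ... | yes refl | _ = trans (irrefl G c) (≡.sym (stable y t))
  ... | no _ | yes refl = trans (stable x (twin-sym t)) (≡.sym (irrefl G c))
  ... | no c≢x | no c≢y = trans (sym G x c) (trans (t c c≢x c≢y) (sym G c y))

  class-stable : ∀ {x y} → Twin c x → Twin c y → adj G x y ≡ false
  class-stable {x} {y} t u with x ≟ y | x ≟ c
  ... | yes refl | _ = irrefl G x
  ... | no _ | yes refl = trans (sym G x y) (stable y u)
  ... | no x≢y | no x≢c = trans (≡.sym (u x x≢c x≢y)) (stable x t)

  -- The alternative, a class of `2 ^ k` vertices, would give `q` a twin.
  special-atom-full : ∀ {A q} → Atom A → q ∈ A → (∀ s → same q s ≡ true) → Special q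
  special-atom-full aA q∈A all with same-true all
  ... | inj₁ sp = sp
  ... | inj₂ fq with y , t , y≢q ← full-twin fq = contradiction (≡.sym (atom-twin aA q∈A t)) y≢q

  -- Take a minimal module `B` inside `A`. Constant links make `B` twin-free, since twins differ in
  -- trace, so `B` is an atom and misses `c`. All of `B` then sees `c` alike and shares the full
  -- trace of its special vertex `p`, which makes a second vertex `q` special too.
  links-vary : ∀ {A} → Homogeneous A → Pair A → ¬ (∀ x y → x ∈ A → y ∈ A → ∀ s → link x s ≡ link y s)
  links-vary {A} hA pA const with B , B⊆A , hB , pB , mB ← minimal-below A hA pA =
    q≢p (special-unique atom q∈B p∈B (special-atom-full atom q∈B q-same) sp)
    where
    atom : Atom B
    atom = hB , pB , mB , λ x y x∈B y∈B t → same-injective t λ s → link-cancel (twin-adj-c t) (const x y (B⊆A x∈B) (B⊆A y∈B) s)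
    p = proj₁ (atom-special atom)
    p∈B = proj₁ (proj₂ (atom-special atom))
    sp = proj₂ (proj₂ (atom-special atom))
    q = proj₁ (other pB p)
    q∈B = proj₁ (proj₂ (other pB p))
    q≢p = proj₂ (proj₂ (other pB p))
    c∉B : c ∉ B
    c∉B c∈B with y , t , y≢c ← full-twin full = y≢c (≡.sym (atom-twin atom c∈B t))
    q-same : ∀ s → same q s ≡ true
    q-same s = trans (link-cancel (trans (sym G q c) (trans (hB c c∉B q p q∈B p∈B) (sym G c p))) (const q p (B⊆A q∈B) (B⊆A p∈B) s))
                     (same-special sp s)

  module _ (P : Fin n ⊎ Fin k → Bool) (mod : IsModuleOn edge P) where

    old : Fin n → Bool
    old x = P (inj₁ x)

    new : Fin k → Bool
    new s = P (inj₂ s)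

    -- x₁ sees all new vertices, x₀ none, although both are twins of c.
    x₁ x₀ : Fin n
    x₁ = proj₁ (same-surjective λ _ → false)
    x₀ = proj₁ (same-surjective λ _ → true)

    t₁ : Twin c x₁
    t₁ = proj₁ (proj₂ (same-surjective λ _ → false))

    t₀ : Twin c x₀
    t₀ = proj₁ (proj₂ (same-surjective λ _ → true))

    link₁ : ∀ s → link x₁ s ≡ true
    link₁ s = trans (link-flip s (proj₂ (proj₂ (same-surjective λ _ → false)) s)) (cong not (stable x₁ t₁))

    link₀ : ∀ s → link x₀ s ≡ false
    link₀ s = trans (link-same s (proj₂ (proj₂ (same-surjective λ _ → true)) s)) (stable x₀ t₀)

    separate : ∀ {x y} → P x ≡ true → P y ≡ false → x ≢ y
    separate px py refl = contradiction (trans (≡.sym px) py) λ ()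

    -- If `x₁` is outside, it is adjacent to `a` because it is adjacent to `s`. With `x₀` inside, it
    -- would also be adjacent to its twin `x₀` in a stable class; with `x₀` outside, `x₀` is not
    -- adjacent to `a`, yet the twins must agree there.
    x₁-in : ∀ {a s} → old a ≡ true → new s ≡ true → old x₁ ≡ true
    x₁-in {a} {s} pa ps = ¬-not λ p₁ → go p₁ (trans (mod (inj₁ x₁) p₁ (inj₁ a) (inj₂ s) pa ps) (link₁ s)) (old x₀) refl
      where
      go : old x₁ ≡ false → adj G x₁ a ≡ true → ∀ b → old x₀ ≡ b → ⊥
      go p₁ e₁ true p₀ = contradiction
        (trans (≡.sym (trans (mod (inj₁ x₁) p₁ (inj₁ x₀) (inj₁ a) p₀ pa) e₁)) (class-stable t₁ t₀)) λ ()
      go p₁ e₁ false p₀ = contradiction (trans (≡.sym e₁) (trans (sym G x₁ a) (trans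
        (twin-trans (twin-sym t₁) t₀ a (λ { refl → separate pa p₁ refl }) (λ { refl → separate pa p₀ refl }))
        (trans (sym G a x₀) (trans (mod (inj₁ x₀) p₀ (inj₁ a) (inj₂ s) pa ps) (link₀ s)))))) λ ()

    -- A new vertex outside would distinguish `x₁`, to which it is adjacent, from `s`, to which it
    -- is not.
    all-new : ∀ {a s} → old a ≡ true → new s ≡ true → ∀ t → new t ≡ true
    all-new {a} {s} pa ps t = ¬-not λ pt → contradiction
      (trans (≡.sym (link₁ t)) (mod (inj₂ t) pt (inj₁ x₁) (inj₂ s) (x₁-in pa ps) ps)) λ ()

    module _ {a s} (pa : old a ≡ true) (ps : new s ≡ true) where

      p₁ : old x₁ ≡ true
      p₁ = x₁-in pa ps

      -- An old vertex outside sees the new vertices as it sees `x₁`, and it sees `x₁` as it sees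
      -- the twin `c`.
      outside-same : ∀ {b} → old b ≡ false → ∀ t → same b t ≡ true
      outside-same {b} pb t = same-of-link t (trans (mod (inj₁ b) pb (inj₂ t) (inj₁ x₁) (all-new pa ps t) p₁) (towards-c b pb))
        where
        towards-c : ∀ b → old b ≡ false → adj G b x₁ ≡ adj G b c
        towards-c b pb with b ≟ c
        ... | yes refl = trans (sym G c x₁) (trans (stable x₁ t₁) (≡.sym (irrefl G c)))
        ... | no b≢c = ≡.sym (t₁ b b≢c λ { refl → separate p₁ pb refl })

      -- Another vertex of the atom lying outside would have the full trace and be a second special
      -- vertex. So the rest of the atom is inside and `b` sees it alike.
      ¬special-outside : ∀ {b} → old b ≡ false → ¬ Special b
      ¬special-outside {b} pb sp@(A , aA , b∈A , _) = atom-indecomposable aA b∈A λ y z y∈A z∈A y≢b z≢b →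
        mod (inj₁ b) pb (inj₁ y) (inj₁ z) (rest y∈A y≢b) (rest z∈A z≢b)
        where
        rest : ∀ {q} → q ∈ A → q ≢ b → old q ≡ true
        rest q∈A q≢b = ¬-not λ pq → q≢b (special-unique aA q∈A b∈A (special-atom-full aA q∈A (outside-same pq)) sp)

      full-outside : ∀ {b} → old b ≡ false → Full b
      full-outside pb with same-true (outside-same pb)
      ... | inj₁ sp = contradiction sp (¬special-outside pb)
      ... | inj₂ fb = fb

      -- Only one member of a twin class has the full trace, so any other twin of `b` is inside.
      twin-inside : ∀ {b} → old b ≡ false → ∃ λ y → Twin b y × old y ≡ true
      twin-inside pb with y , t , y≢b ← full-twin (full-outside pb) =
        y , t , ¬-not λ py → y≢b (≡.sym (same-injective t λ s → trans (outside-same pb s) (≡.sym (outside-same py s))))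

      -- Vertices inside are seen by `b` alike, and a vertex outside is seen as its twin inside is.
      dominated-outside : ∀ {b} → old b ≡ false → Dominated b
      dominated-outside {b} pb = adj G b x₁ , λ y y≢b → to-x₁ y≢b (old y) refl
        where
        to-x₁ : ∀ {y} → y ≢ b → ∀ β → old y ≡ β → adj G b y ≡ adj G b x₁
        to-x₁ {y} y≢b true py = mod (inj₁ b) pb (inj₁ y) (inj₁ x₁) py p₁
        to-x₁ {y} y≢b false py with z , t , pz ← twin-inside py =
          trans (t b (≢-sym y≢b) λ { refl → separate pz pb refl }) (mod (inj₁ b) pb (inj₁ z) (inj₁ x₁) pz p₁)

      everything : ∀ v → P v ≡ true
      everything (inj₁ b) = ¬-not λ pb → undominated b (full-outside pb) (dominated-outside pb)
      everything (inj₂ t) = all-new pa ps t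

    -- The old part is a module of `G`, and all new vertices, being outside, see it alike: its links
    -- would be constant.
    no-new : ∀ {x y} → old x ≡ true → old y ≡ true → x ≢ y → (∀ s → new s ≡ false) → ⊥
    no-new {x} {y} px py x≢y none = links-vary {filter old?}
      (λ z z∉ u v u∈ v∈ → mod (inj₁ z) (¬-not λ pz → z∉ (∈-filter⁺ old? pz)) (inj₁ u) (inj₁ v)
        (∈-filter⁻ old? u∈) (∈-filter⁻ old? v∈))
      (x , y , ∈-filter⁺ old? px , ∈-filter⁺ old? py , x≢y)
      λ u v u∈ v∈ s → mod (inj₂ s) (none s) (inj₁ u) (inj₁ v) (∈-filter⁻ old? u∈) (∈-filter⁻ old? v∈)
      where
      old? : Decidable (λ x → old x ≡ true)
      old? x = old x Bool.≟ true

    -- The twin of `c` whose trace is the indicator of `s` distinguishes `s` from `t`.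
    no-old : ∀ {s t} → new s ≡ true → new t ≡ true → s ≢ t → (∀ x → old x ≡ false) → ⊥
    no-old {s} {t} ps pt s≢t none with x , _ , eq ← same-surjective (λ r → does (r ≟ s)) =
      contradiction (trans (≡.sym (trans (eq s) (dec-true (s ≟ s) refl)))
        (trans (link-cancel {x} {x} refl (mod (inj₁ x) (none x) (inj₂ s) (inj₂ t) ps pt))
          (trans (eq t) (dec-false (t ≟ s) (≢-sym s≢t))))) λ ()

  edge-prime : PrimeOn edge
  edge-prime P mod u v pu pv u≢v =
    go u v pu pv u≢v (any? λ x → P (inj₁ x) Bool.≟ true) (any? λ s → P (inj₂ s) Bool.≟ true)
    where
    go : ∀ u v → P u ≡ true → P v ≡ true → u ≢ v → Dec (∃ λ x → P (inj₁ x) ≡ true) → Dec (∃ λ s → P (inj₂ s) ≡ true) →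
         ∀ w → P w ≡ true
    go u v pu pv u≢v (yes (a , pa)) (yes (s , ps)) = everything P mod pa ps
    go (inj₁ x) _ pu _ _ (no none) _ = contradiction (x , pu) none
    go _ (inj₁ x) _ pv _ (no none) _ = contradiction (x , pv) none
    go (inj₂ s) (inj₂ t) pu pv u≢v (no none) _ =
      ⊥-elim (no-old P mod pu pv (λ s≡t → u≢v (cong inj₂ s≡t)) λ x → ¬-not λ px → none (x , px))
    go (inj₂ s) _ pu _ _ _ (no none) = contradiction (s , pu) none
    go _ (inj₂ s) _ pv _ _ (no none) = contradiction (s , pv) none
    go (inj₁ x) (inj₁ y) pu pv u≢v _ (no none) =
      ⊥-elim (no-new P mod pu pv (λ x≡y → u≢v (cong inj₁ x≡y)) λ s → ¬-not λ ps → none (s , ps))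

-- Transport of primeness to graphs on `Fin (n + p)`.

homogeneous⇒module : ∀ {n} (G : Graph n) M → Twins.Homogeneous G M → IsModule G M
homogeneous⇒module G M h z z∉M with nonempty? M
... | no empty = inj₁ λ y y∈M → contradiction (y , y∈M) empty
... | yes (x , x∈M) with adj G z x in eq
... | true = inj₁ λ y y∈M → trans (h z z∉M y x y∈M x∈M) eq
... | false = inj₂ λ y y∈M → trans (h z z∉M y x y∈M x∈M) eq

module⇒homogeneous : ∀ {n} (G : Graph n) M → IsModule G M → Twins.Homogeneous G M
module⇒homogeneous G M mod z z∉M x y x∈M y∈M with mod z z∉M
... | inj₁ all = trans (all x x∈M) (≡.sym (all y y∈M))
... | inj₂ none = trans (none x x∈M) (≡.sym (none y y∈M))

module _ {n p} (G : Graph n) {V : Set} (e : V → V → Bool)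
         (e-sym : ∀ u v → e u v ≡ e v u) (e-irrefl : ∀ u → e u u ≡ false) (e-prime : PrimeOn e)
         (to : Fin (n + p) → V) (from : V → Fin (n + p)) (from-to : ∀ i → from (to i) ≡ i) (to-from : ∀ v → to (from v) ≡ v)
         (restricts : ∀ x y → e (to (x ↑ˡ p)) (to (y ↑ˡ p)) ≡ adj G x y) (4≤ : 4 ≤ n + p) where

  relabel : HasPrimeExtension G p
  relabel = H , restricts , 4≤ , trivial
    where
    H : Graph (n + p)
    H = record { adj = λ i j → e (to i) (to j) ; sym = λ i j → e-sym (to i) (to j) ; irrefl = λ i → e-irrefl (to i) }

    trivial : ∀ M → IsModule H M → IsTrivial M
    trivial M mod with pair? M
    ... | yes (x , y , x∈M , y∈M , x≢y) = inj₂ (inj₁ (⊆-antisym (λ _ → ∈⊤) λ {z} _ →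
      subst (_∈ M) (from-to z) (∈-of (e-prime P P-module (to x) (to y) (of-∈ x∈M) (of-∈ y∈M)
        (λ eq → x≢y (trans (≡.sym (from-to x)) (trans (cong from eq) (from-to y)))) (to z)))))
      where
      P : V → Bool
      P v = does (from v ∈? M)
      ∈-of : ∀ {v} → P v ≡ true → from v ∈ M
      ∈-of {v} pv with from v ∈? M
      ... | yes v∈ = v∈
      of-∈ : ∀ {i} → i ∈ M → P (to i) ≡ true
      of-∈ {i} i∈M = dec-true (from (to i) ∈? M) (subst (_∈ M) (≡.sym (from-to i)) i∈M)
      P-module : IsModuleOn e P
      P-module z pz u v pu pv = subst₂ _≡_ (cong₂ e (to-from z) (to-from u)) (cong₂ e (to-from z) (to-from v))
        (module⇒homogeneous H M mod (from z)
          (λ z∈ → contradiction (trans (≡.sym pz) (dec-true (from z ∈? M) z∈)) λ ()) (from u) (from v) (∈-of pu) (∈-of pv))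
    ... | no ¬pair with nonempty? M
    ...   | no empty = inj₁ (Empty-unique empty)
    ...   | yes (x , x∈M) = inj₂ (inj₂ (x , ⊆-antisym
      (λ {y} y∈M → subst (_∈ ⁅ x ⁆) (decidable-stable (x ≟ y) λ x≢y → ¬pair (x , y , x∈M , y∈M , x≢y)) (x∈⁅x⁆ x))
      (λ y∈ → subst (_∈ M) (≡.sym (x∈⁅y⁆⇒x≡y x y∈)) x∈M)))

-- Complementation.

record Opposite {n} (G G' : Graph n) : Set where
  constructor opposite
  field flips : ∀ x y → x ≢ y → adj G' x y ≡ not (adj G x y)
open Opposite

-- This symmetry is the reason for a relation beside the function `complement`, which is involutive
-- only pointwise.
opposite-sym : ∀ {n} {G G' : Graph n} → Opposite G G' → Opposite G' G
opposite-sym opp = opposite λ x y x≢y → trans (≡.sym (not-involutive _)) (cong not (≡.sym (flips opp x y x≢y)))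

complement-opposite : ∀ {n} (G : Graph n) → Opposite G (complement G)
complement-opposite G = opposite flip
  where
  flip : ∀ x y → x ≢ y → adj (complement G) x y ≡ not (adj G x y)
  flip x y x≢y with x ≟ y
  ... | yes x≡y = contradiction x≡y x≢y
  ... | no _ = refl

module _ {n} {G G' : Graph n} (opp : Opposite G G') where

  opposite-twin : ∀ {x y} → Twins.Twin G x y → Twins.Twin G' x y
  opposite-twin t z z≢x z≢y = trans (flips opp z _ z≢x) (trans (cong not (t z z≢x z≢y)) (≡.sym (flips opp z _ z≢y)))

  opposite-module : ∀ {M} → IsModule G M → IsModule G' M
  opposite-module mod x x∉M with mod x x∉M
  ... | inj₁ all = inj₂ λ y y∈M → trans (flips opp x y λ { refl → x∉M y∈M }) (cong not (all y y∈M))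
  ... | inj₂ none = inj₁ λ y y∈M → trans (flips opp x y λ { refl → x∉M y∈M }) (cong not (none y y∈M))

  opposite-clique : ∀ {M} → IsClique G M → IsStable G' M
  opposite-clique clique x y x∈M y∈M with x ≟ y
  ... | yes refl = irrefl G' x
  ... | no x≢y = trans (flips opp x y x≢y) (cong not (clique x y x∈M y∈M x≢y))

  opposite-stable : ∀ {M} → IsStable G M → IsClique G' M
  opposite-stable stable x y x∈M y∈M x≢y = trans (flips opp x y x≢y) (cong not (stable x y x∈M y∈M))

opposite-prime : ∀ {n} {G G' : Graph n} → Opposite G G' → IsPrime G → IsPrime G'
opposite-prime opp (4≤n , trivial) = 4≤n , λ M mod → trivial M (opposite-module (opposite-sym opp) mod)

opposite-extension : ∀ {n p} {G G' : Graph n} → Opposite G G' → HasPrimeExtension G p → HasPrimeExtension G' p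
opposite-extension {n} {p} {G} {G'} opp (H , ext , prime) = complement H , ext' , opposite-prime (complement-opposite H) prime
  where
  ext' : IsExtension p G' (complement H)
  ext' x y with x ≟ y
  ... | yes refl = trans (irrefl (complement H) (x ↑ˡ p)) (≡.sym (irrefl G' x))
  ... | no x≢y = trans (flips (complement-opposite H) _ _ (x≢y ∘ ↑ˡ-injective p x y))
    (trans (cong not (ext x y)) (≡.sym (flips opp x y x≢y)))

isoSize-cong : ∀ {n s} (G G' : Graph n) → (∀ x y → adj G x y ≡ adj G' x y) → IsoSize G s → IsoSize G' s
isoSize-cong G G' eq (S , iso , size) =
  S , (λ v → (λ v∈S w → trans (≡.sym (eq v w)) (proj₁ (iso v) v∈S w)) , λ iv → proj₂ (iso v) λ w → trans (eq v w) (iv w)) , size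

isolated? : ∀ {n} (G : Graph n) → Decidable (Isolated G)
isolated? G v = all? λ w → adj G v w Bool.≟ false

isoSize? : ∀ {n} (G : Graph n) s → Dec (IsoSize G s)
isoSize? G s with ∣ filter (isolated? G) ∣ ℕ.≟ s
... | yes eq = yes (filter (isolated? G) , (λ v → ∈-filter⁻ (isolated? G) , ∈-filter⁺ (isolated? G)) , eq)
... | no neq = no λ { (S , iso , size) → neq (trans (cong ∣_∣ (⊆-antisym {i = filter (isolated? G)} {j = S}
  (λ {v} v∈ → proj₂ (iso v) (∈-filter⁻ (isolated? G) v∈)) (λ {v} v∈ → ∈-filter⁺ (isolated? G) (proj₁ (iso v) v∈)))) size) }

-- Modules that are cliques or stable sets, and their relation to twin classes.

Uniform : ∀ {n} → Graph n → Subset n → Set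
Uniform G M = IsClique G M ⊎ IsStable G M

-- The inequality `m(G) ≤ m`, in a form invariant under complementation.
Bounded : ∀ {n} → Graph n → ℕ → Set
Bounded G m = ∀ M → IsModule G M → Uniform G M → ∣ M ∣ ≤ m

opposite-uniform : ∀ {n} {G G' : Graph n} {M} → Opposite G G' → Uniform G M → Uniform G' M
opposite-uniform opp (inj₁ clique) = inj₂ (opposite-clique opp clique)
opposite-uniform opp (inj₂ stable) = inj₁ (opposite-stable opp stable)

opposite-bounded : ∀ {n m} {G G' : Graph n} → Opposite G G' → Bounded G m → Bounded G' m
opposite-bounded opp bound M mod uni =
  bound M (opposite-module (opposite-sym opp) mod) (opposite-uniform (opposite-sym opp) uni)

module _ {n} (G : Graph n) where
  open Twins G

  uniform-twins : ∀ {M} → IsModule G M → Uniform G M → ∀ {x y} → x ∈ M → y ∈ M → Twin x y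
  uniform-twins {M} mod uni {x} {y} x∈M y∈M z z≢x z≢y with z ∈? M
  ... | no z∉M = module⇒homogeneous G M mod z z∉M x y x∈M y∈M
  ... | yes z∈M with uni
  ... | inj₁ clique = trans (clique z x z∈M x∈M z≢x) (≡.sym (clique z y z∈M y∈M z≢y))
  ... | inj₂ stable = trans (stable z x z∈M x∈M) (≡.sym (stable z y z∈M y∈M))

  -- The endpoints are exchanged for twins one at a time, which keeps the adjacency while they stay
  -- distinct.
  twin-edges : ∀ {x y a b} → Twin x y → x ≢ y → Twin x a → Twin x b → a ≢ b → adj G a b ≡ adj G x y
  twin-edges {x} {y} {a} {b} ty x≢y ta tb a≢b with a ≟ x | b ≟ x
  ... | yes refl | _ = twin-trans (twin-sym tb) ty x a≢b x≢y
  ... | no a≢x | yes refl = trans (sym G a x) (twin-trans (twin-sym ta) ty x (≢-sym a≢x) x≢y)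
  ... | no a≢x | no _ = trans (twin-sym tb a a≢b a≢x) (trans (sym G a x) (twin-trans (twin-sym ta) ty x (≢-sym a≢x) x≢y))

  class-uniform : ∀ x → Uniform G (class x)
  class-uniform x with any? (λ y → twin? x y ×-dec ¬? (x ≟ y))
  ... | no none = inj₁ λ a b a∈ b∈ a≢b → contradiction (trans (≡.sym (alone a∈)) (alone b∈)) a≢b
    where
    alone : ∀ {a} → a ∈ class x → x ≡ a
    alone {a} a∈ = decidable-stable (x ≟ a) λ x≢a → none (a , ∈-class⁻ a∈ , x≢a)
  ... | yes (y , t , x≢y) with adj G x y in eq
  ... | true = inj₁ λ a b a∈ b∈ a≢b → trans (twin-edges t x≢y (∈-class⁻ a∈) (∈-class⁻ b∈) a≢b) eq
  ... | false = inj₂ stable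
    where
    stable : IsStable G (class x)
    stable a b a∈ b∈ with a ≟ b
    ... | yes refl = irrefl G a
    ... | no a≢b = trans (twin-edges t x≢y (∈-class⁻ a∈) (∈-class⁻ b∈) a≢b) eq

  class-bounded : ∀ {m} → Bounded G m → ∀ x → ∣ class x ∣ ≤ m
  class-bounded bound x = bound (class x) (homogeneous⇒module G _ (class-homogeneous x)) (class-uniform x)

  -- Isolated vertices are twins of each other, and a twin of an isolated vertex is isolated, so
  -- this class is the whole set of isolated vertices.
  isolated-class : ∀ {b} → (∀ y → y ≢ b → adj G b y ≡ false) → IsoSize G ∣ class b ∣
  isolated-class {b} iso = class b , (λ v → (λ v∈ → isolated v (∈-class⁻ v∈)) , λ iv → ∈-class⁺ λ z z≢b z≢v →
    trans (sym G z b) (trans (iso z z≢b) (≡.sym (trans (sym G z v) (iv z))))) , refl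
    where
    isolated : ∀ v → Twin b v → Isolated G v
    isolated v t w with v ≟ w | v ≟ b | w ≟ b
    ... | yes refl | _ | _ = irrefl G v
    ... | no v≢w | yes refl | _ = iso w (≢-sym v≢w)
    ... | no _ | no v≢b | yes refl = trans (sym G v w) (iso v v≢b)
    ... | no v≢w | no v≢b | no w≢b = trans (sym G v w) (trans (≡.sym (t w w≢b (≢-sym v≢w))) (trans (sym G w b) (iso w w≢b)))

class-opposite : ∀ {n} {G G' : Graph n} → Opposite G G' → ∀ x → Twins.class G x ≡ Twins.class G' x
class-opposite {G = G} {G'} opp x = ⊆-antisym
  (λ y∈ → Twins.∈-class⁺ G' (opposite-twin opp (Twins.∈-class⁻ G y∈)))
  (λ y∈ → Twins.∈-class⁺ G (opposite-twin (opposite-sym opp) (Twins.∈-class⁻ G' y∈)))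

-- Upper bound `k` when neither graph has `2 ^ k` isolated vertices.

module _ {n} (G : Graph n) (k : ℕ) (1≤k : 1 ≤ k) where
  open Twins G

  stable-extension : ∀ {C} → Bounded G (2 ^ k) → IsModule G C → IsStable G C → ∣ C ∣ ≡ 2 ^ k →
    ¬ IsoSize G (2 ^ k) → ¬ IsoSize (complement G) (2 ^ k) → HasPrimeExtension G k
  stable-extension {C} bound mod stab size ¬iso ¬iso' =
    relabel G B.edge B.edge-sym B.edge-irrefl B.edge-prime (splitAt n) (join n k) (join-splitAt n k) (splitAt-join n k)
      (λ x y → cong₂ B.edge (splitAt-↑ˡ n x k) (splitAt-↑ˡ n y k)) (ℕ.+-mono-≤ (ℕ.≤-trans (s≤s 2≤2^k) 2^k<n) 1≤k)
    where
    2≤2^k : 2 ≤ 2 ^ k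
    2≤2^k = ℕ.^-monoʳ-≤ 2 1≤k

    C-pair : Pair C
    C-pair = 2≤∣∣⇒Pair C (subst (2 ≤_) (≡.sym size) 2≤2^k)

    c c' : Fin n
    c = proj₁ C-pair
    c' = proj₁ (proj₂ C-pair)

    c∈C : c ∈ C
    c∈C = proj₁ (proj₂ (proj₂ C-pair))

    c'∈C : c' ∈ C
    c'∈C = proj₁ (proj₂ (proj₂ (proj₂ C-pair)))

    c≢c' : c ≢ c'
    c≢c' = proj₂ (proj₂ (proj₂ (proj₂ C-pair)))

    cap : ∀ x → ∣ class x ∣ ≤ 2 ^ k
    cap = class-bounded G bound

    twins : ∀ {y} → y ∈ C → Twin c y
    twins = uniform-twins G mod (inj₂ stab) c∈C

    c-full : ∣ class c ∣ ≡ 2 ^ k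
    c-full = ℕ.≤-antisym (cap c) (subst (_≤ ∣ class c ∣) size
      (p⊆q⇒∣p∣≤∣q∣ {p = C} {q = class c} λ y∈ → ∈-class⁺ (twins y∈)))

    stable : ∀ y → Twin c y → adj G y c ≡ false
    stable y t with y ≟ c
    ... | yes refl = irrefl G y
    ... | no y≢c = trans (twin-edges G (twins c'∈C) c≢c' t twin-refl y≢c) (stab c c' c∈C c'∈C)

    undominated : ∀ b → ∣ class b ∣ ≡ 2 ^ k → ¬ Dominated b
    -- A full class of isolated vertices is excluded for `G`, one of universal vertices for the
    -- complement.
    undominated b fb (false , dom) = ¬iso (subst (IsoSize G) fb (isolated-class G dom))
    undominated b fb (true , dom) = ¬iso' (subst (IsoSize (complement G))
      (trans (cong ∣_∣ (≡.sym (class-opposite (complement-opposite G) b))) fb)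
      (isolated-class (complement G) λ y y≢b → trans (flips (complement-opposite G) b y (≢-sym y≢b)) (cong not (dom y y≢b))))

    -- If the class of `c` were everything, `c` would be isolated with a full class. Strictness
    -- gives `n` at least 3, as needed for four vertices when `k` is 1.
    2^k<n : 2 ^ k < n
    2^k<n = ℕ.≤∧≢⇒< (subst (_≤ n) c-full (∣p∣≤n (class c))) λ 2^k≡n → undominated c c-full (false , λ y _ →
      trans (sym G c y) (stable y (∈-class⁻ (subst (y ∈_) (≡.sym (∣p∣≡n⇒p≡⊤ (trans c-full 2^k≡n))) ∈⊤))))

    module B = Construction G k 1≤k c cap c-full stable undominated

-- Upper bound `k + 1` when there are `2 ^ k` isolated vertices.

cone : ∀ {n} → Graph n → Graph (suc n)
cone {n} G = record { adj = a ; sym = s ; irrefl = i }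
  where
  a : Fin (suc n) → Fin (suc n) → Bool
  a zero zero = false
  a zero (suc _) = true
  a (suc _) zero = true
  a (suc x) (suc y) = adj G x y
  s : ∀ x y → a x y ≡ a y x
  s zero zero = refl
  s zero (suc _) = refl
  s (suc _) zero = refl
  s (suc x) (suc y) = sym G x y
  i : ∀ x → a x x ≡ false
  i zero = refl
  i (suc x) = irrefl G x

-- The apex has no twin because there are isolated vertices, so the cone has the same twin classes apart from {apex}.
module _ {n} (G : Graph n) (k : ℕ) (1≤k : 1 ≤ k) where
  open Twins G
  module T⁺ = Twins (cone G)

  isolated-extension : Bounded G (2 ^ k) → IsoSize G (2 ^ k) → HasPrimeExtension G (suc k)
  isolated-extension bound (I , iso , size) =
    relabel G B.edge B.edge-sym B.edge-irrefl B.edge-prime to from from-to to-from restricts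
      (ℕ.+-mono-≤ (ℕ.≤-trans 2≤2^k (subst (_≤ n) size (∣p∣≤n I))) (s≤s 1≤k))
    where
    2≤2^k : 2 ≤ 2 ^ k
    2≤2^k = ℕ.^-monoʳ-≤ 2 1≤k

    I-pair : Pair I
    I-pair = 2≤∣∣⇒Pair I (subst (2 ≤_) (≡.sym size) 2≤2^k)

    isolated : ∀ {v} → v ∈ I → Isolated G v
    isolated {v} = proj₁ (iso v)

    c : Fin n
    c = proj₁ I-pair

    c∈I : c ∈ I
    c∈I = proj₁ (proj₂ (proj₂ I-pair))

    apex-twin : ∀ {x} → ¬ T⁺.Twin zero (suc x)
    apex-twin {x} t with i , i∈I , i≢x ← other I-pair x =
      contradiction (trans (t (suc i) (λ ()) (λ { refl → i≢x refl })) (isolated i∈I x)) λ ()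

    old-twin : ∀ {x y} → T⁺.Twin (suc x) (suc y) → Twin x y
    old-twin t z z≢x z≢y = t (suc z) (λ { refl → z≢x refl }) (λ { refl → z≢y refl })

    apex-class : ∣ T⁺.class zero ∣ ≤ 1
    apex-class = subst (∣ T⁺.class zero ∣ ≤_) (∣⁅x⁆∣≡1 {suc n} zero)
      (p⊆q⇒∣p∣≤∣q∣ {p = T⁺.class zero} {q = ⁅ zero ⁆} only)
      where
      only : ∀ {y} → y ∈ T⁺.class zero → y ∈ ⁅ zero ⁆
      only {zero} _ = here
      only {suc y} y∈ = contradiction (T⁺.∈-class⁻ y∈) apex-twin

    cap : ∀ x → ∣ T⁺.class x ∣ ≤ 2 ^ k
    cap zero = ℕ.≤-trans apex-class (ℕ.<⇒≤ 2≤2^k)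
    cap (suc x) = ℕ.≤-trans (p⊆q⇒∣p∣≤∣q∣ {p = T⁺.class (suc x)} {q = false ∷ class x} old) (class-bounded G bound x)
      where
      old : ∀ {y} → y ∈ T⁺.class (suc x) → y ∈ false ∷ class x
      old {zero} y∈ = contradiction (T⁺.twin-sym (T⁺.∈-class⁻ y∈)) apex-twin
      old {suc y} y∈ = there (∈-class⁺ (old-twin (T⁺.∈-class⁻ y∈)))

    c-full : ∣ T⁺.class (suc c) ∣ ≡ 2 ^ k
    c-full = ℕ.≤-antisym (cap (suc c)) (subst (_≤ ∣ T⁺.class (suc c) ∣) size
      (p⊆q⇒∣p∣≤∣q∣ {p = false ∷ I} {q = T⁺.class (suc c)} λ { {suc y} (there y∈I) → T⁺.∈-class⁺ (twin y∈I) }))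
      where
      twin : ∀ {y} → y ∈ I → T⁺.Twin (suc c) (suc y)
      twin y∈I zero _ _ = refl
      twin {y} y∈I (suc z) _ _ = trans (sym G z c) (trans (isolated c∈I z) (≡.sym (trans (sym G z y) (isolated y∈I z))))

    stable : ∀ y → T⁺.Twin (suc c) y → adj (cone G) y (suc c) ≡ false
    stable zero t = contradiction (T⁺.twin-sym t) apex-twin
    stable (suc y) t = trans (sym G y c) (isolated c∈I y)

    undominated : ∀ b → ∣ T⁺.class b ∣ ≡ 2 ^ k → ¬ T⁺.Dominated b
    undominated zero fb _ = ℕ.<⇒≱ 2≤2^k (subst (_≤ 1) fb apex-class)
    -- The vertex `suc b` is adjacent to the apex but not to an isolated vertex of `G` other than
    -- `b`.
    undominated (suc b) _ (β , dom) with i , i∈I , i≢b ← other I-pair b =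
      contradiction (trans (≡.sym (isolated i∈I b)) (trans (sym G i b)
        (trans (dom (suc i) λ { refl → i≢b refl }) (≡.sym (dom zero λ ()))))) λ ()

    module B = Construction (cone G) k 1≤k (suc c) cap c-full stable undominated

    -- The apex is an old vertex for the construction over the cone, but the first of the `suc k`
    -- new vertices over `G`.
    regroup : Fin n ⊎ Fin (suc k) → Fin (suc n) ⊎ Fin k
    regroup (inj₁ x) = inj₁ (suc x)
    regroup (inj₂ zero) = inj₁ zero
    regroup (inj₂ (suc s)) = inj₂ s

    ungroup : Fin (suc n) ⊎ Fin k → Fin n ⊎ Fin (suc k)
    ungroup (inj₁ zero) = inj₂ zero
    ungroup (inj₁ (suc x)) = inj₁ x
    ungroup (inj₂ s) = inj₂ (suc s)

    ungroup-regroup : ∀ u → ungroup (regroup u) ≡ u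
    ungroup-regroup (inj₁ x) = refl
    ungroup-regroup (inj₂ zero) = refl
    ungroup-regroup (inj₂ (suc s)) = refl

    regroup-ungroup : ∀ v → regroup (ungroup v) ≡ v
    regroup-ungroup (inj₁ zero) = refl
    regroup-ungroup (inj₁ (suc x)) = refl
    regroup-ungroup (inj₂ s) = refl

    to : Fin (n + suc k) → Fin (suc n) ⊎ Fin k
    to = regroup ∘ splitAt n

    from : Fin (suc n) ⊎ Fin k → Fin (n + suc k)
    from = join n (suc k) ∘ ungroup

    from-to : ∀ i → from (to i) ≡ i
    from-to i = trans (cong (join n (suc k)) (ungroup-regroup (splitAt n i))) (join-splitAt n (suc k) i)

    to-from : ∀ v → to (from v) ≡ v
    to-from v = trans (cong regroup (splitAt-join n (suc k) (ungroup v))) (regroup-ungroup v)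

    restricts : ∀ x y → B.edge (to (x ↑ˡ suc k)) (to (y ↑ˡ suc k)) ≡ adj G x y
    restricts x y = cong₂ (λ u v → B.edge (regroup u) (regroup v)) (splitAt-↑ˡ n x (suc k)) (splitAt-↑ˡ n y (suc k))

-- Prime graphs have neither distinct twins nor isolated vertices.

module _ {n} (H : Graph n) (prime : IsPrime H) where
  open Twins H

  private
    4≤n : 4 ≤ n
    4≤n = proj₁ prime

    trivial : ∀ M → IsModule H M → IsTrivial M
    trivial = proj₂ prime

  prime-twin : ∀ {x y} → Twin x y → x ≡ y
  prime-twin {x} {y} t with x ≟ y
  ... | yes x≡y = x≡y
  ... | no x≢y = ⊥-elim (absurd (trivial (filter M?) (homogeneous⇒module H _ λ z z∉ u v u∈ v∈ →
    agree z (λ z≡x → z∉ (∈-filter⁺ M? (inj₁ z≡x))) (λ z≡y → z∉ (∈-filter⁺ M? (inj₂ z≡y)))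
      (∈-filter⁻ M? u∈) (∈-filter⁻ M? v∈))))
    where
    M? : Decidable (λ z → z ≡ x ⊎ z ≡ y)
    M? z = z ≟ x ⊎-dec z ≟ y

    agree : ∀ z → z ≢ x → z ≢ y → ∀ {u v} → u ≡ x ⊎ u ≡ y → v ≡ x ⊎ v ≡ y → adj H z u ≡ adj H z v
    agree z z≢x z≢y (inj₁ refl) (inj₁ refl) = refl
    agree z z≢x z≢y (inj₁ refl) (inj₂ refl) = t z z≢x z≢y
    agree z z≢x z≢y (inj₂ refl) (inj₁ refl) = ≡.sym (t z z≢x z≢y)
    agree z z≢x z≢y (inj₂ refl) (inj₂ refl) = refl

    side : Fin n → Fin 2
    side z = ofBit (does (z ≟ x))

    absurd : ¬ IsTrivial (filter M?)
    absurd (inj₁ eq) = ∉⊥ (subst (x ∈_) eq (∈-filter⁺ M? (inj₁ refl)))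
    absurd (inj₂ (inj₂ (v , eq))) = x≢y (trans (x∈⁅y⁆⇒x≡y v (subst (x ∈_) eq (∈-filter⁺ M? (inj₁ refl))))
      (≡.sym (x∈⁅y⁆⇒x≡y v (subst (y ∈_) eq (∈-filter⁺ M? (inj₂ refl))))))
    -- If `x` and `y` were the only vertices, two of the at least four would fall on the same side.
    absurd (inj₂ (inj₁ eq)) with i , j , i<j , same ← pigeonhole (ℕ.≤-trans (s≤s (s≤s (s≤s z≤n))) 4≤n) side =
      clash (either i) (either j) same i<j
      where
      either : ∀ z → z ≡ x ⊎ z ≡ y
      either z = ∈-filter⁻ M? (subst (z ∈_) (≡.sym eq) ∈⊤)
      clash : ∀ {i j} → i ≡ x ⊎ i ≡ y → j ≡ x ⊎ j ≡ y → side i ≡ side j → i Fin.< j → ⊥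
      clash (inj₁ refl) (inj₁ refl) _ i<j = ℕ.<-irrefl refl i<j
      clash (inj₂ refl) (inj₂ refl) _ i<j = ℕ.<-irrefl refl i<j
      clash (inj₁ refl) (inj₂ refl) same _ rewrite dec-true (x ≟ x) refl | dec-false (y ≟ x) (≢-sym x≢y) = contradiction same λ ()
      clash (inj₂ refl) (inj₁ refl) same _ rewrite dec-true (x ≟ x) refl | dec-false (y ≟ x) (≢-sym x≢y) = contradiction same λ ()

  -- All vertices but `x` would form a module, of size `n - 1`, at least 3 and hence nontrivial.
  prime-isolated : ∀ {x} → ¬ Isolated H x
  prime-isolated {x} iso = absurd (trivial (∁ ⁅ x ⁆) λ z z∉ → inj₂ λ y _ →
      subst (λ v → adj H v y ≡ false) (≡.sym (x∈⁅y⁆⇒x≡y x (x∉∁p⇒x∈p z∉))) (iso y))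
    where
    size : ∣ ∁ ⁅ x ⁆ ∣ ≡ n ∸ 1
    size = trans (∣∁p∣≡n∸∣p∣ ⁅ x ⁆) (cong (n ∸_) (∣⁅x⁆∣≡1 x))
    large : ∀ {m} → m ≤ 1 → n ∸ 1 ≢ m
    large m≤1 eq = contradiction (ℕ.≤-trans (ℕ.∸-monoˡ-≤ 1 4≤n) (subst (_≤ 1) (≡.sym eq) m≤1)) λ { (s≤s ()) }
    absurd : ¬ IsTrivial (∁ ⁅ x ⁆)
    absurd (inj₁ eq) = large z≤n (trans (≡.sym size) (trans (cong ∣_∣ eq) (∣⊥∣≡0 n)))
    absurd (inj₂ (inj₁ eq)) = x∈∁p⇒x∉p (subst (x ∈_) (≡.sym eq) ∈⊤) (x∈⁅x⁆ x)
    absurd (inj₂ (inj₂ (v , eq))) = large (s≤s z≤n) (trans (≡.sym size) (trans (cong ∣_∣ eq) (∣⁅x⁆∣≡1 v)))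

-- Lower bounds from traces on the new vertices.

module _ {n q} (G : Graph n) (H : Graph (n + q)) (ext : IsExtension q G H) (prime : IsPrime H) where
  open Twins G

  trace : Fin n → Fin q → Bool
  trace x s = adj H (x ↑ˡ q) (n ↑ʳ s)

  -- Twins of `G` with equal traces stay twins in the prime graph `H`.
  trace-injective : ∀ {x y} → Twin x y → (∀ s → trace x s ≡ trace y s) → x ≡ y
  trace-injective {x} {y} t eq = ↑ˡ-injective q x y (prime-twin H prime twin)
    where
    twin : Twins.Twin H (x ↑ˡ q) (y ↑ˡ q)
    twin z z≢x z≢y with splitAt n z | join-splitAt n q z
    ... | inj₁ w | refl = trans (ext w x) (trans (t w (λ { refl → z≢x refl }) (λ { refl → z≢y refl })) (≡.sym (ext w y)))
    ... | inj₂ s | refl = trans (sym H _ _) (trans (eq s) (sym H _ _))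

  trace-isolated : ∀ {x} → Isolated G x → ¬ (∀ s → trace x s ≡ false)
  trace-isolated {x} iso none = prime-isolated H prime isolated
    where
    isolated : Isolated H (x ↑ˡ q)
    isolated z with splitAt n z | join-splitAt n q z
    ... | inj₁ w | refl = trans (ext x w) (iso w)
    ... | inj₂ s | refl = none s

  module _ (S : Subset n) (twins : ∀ {x y} → x ∈ S → y ∈ S → Twin x y) where

    element : (i : Fin ∣ S ∣) → ∃ λ x → x ∈ S × rank S x ≡ toℕ i
    element i = rank-surjective S (toℕ<n i)

    code : Fin ∣ S ∣ → Fin (2 ^ q)
    code i = fromBits q (trace (proj₁ (element i)))

    fromBits-injective : ∀ {φ ψ : Fin q → Bool} → fromBits q φ ≡ fromBits q ψ → ∀ s → φ s ≡ ψ s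
    fromBits-injective {φ} {ψ} eq s = trans (≡.sym (bits-fromBits q φ s)) (trans (cong (λ i → bits q i s) eq) (bits-fromBits q ψ s))

    code-injective : ∀ {i j} → code i ≡ code j → i ≡ j
    code-injective {i} {j} eq with x , x∈ , rx ← element i | y , y∈ , ry ← element j =
      toℕ-injective (trans (≡.sym rx) (trans (cong (rank S) (trace-injective (twins x∈ y∈) (fromBits-injective eq))) ry))

    twins-bound : ∣ S ∣ ≤ 2 ^ q
    twins-bound = injective⇒≤ {f = code} code-injective

    -- The zero word is never the trace of an isolated vertex, so it can be added to the codes as
    -- one more value without losing injectivity.
    isolated-bound : (∀ {x} → x ∈ S → Isolated G x) → ∣ S ∣ < 2 ^ q
    isolated-bound iso = injective⇒≤ {f = code'} code'-injective
      where
      code' : Fin (suc ∣ S ∣) → Fin (2 ^ q)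
      code' zero = fromBits q λ _ → false
      code' (suc i) = code i
      nonzero : ∀ i → code i ≢ fromBits q λ _ → false
      nonzero i eq = trace-isolated (iso (proj₁ (proj₂ (element i)))) (fromBits-injective eq)
      code'-injective : ∀ {i j} → code' i ≡ code' j → i ≡ j
      code'-injective {zero} {zero} _ = refl
      code'-injective {zero} {suc j} eq = contradiction (≡.sym eq) (nonzero j)
      code'-injective {suc i} {zero} eq = contradiction eq (nonzero i)
      code'-injective {suc i} {suc j} eq = cong suc (code-injective eq)

module _ {n} (G : Graph n) where
  open Twins G

  uniform-lower : ∀ {M k q} → IsModule G M → Uniform G M → ∣ M ∣ ≡ 2 ^ k → HasPrimeExtension G q → k ≤ q
  uniform-lower {M} {k} {q} mod uni size (H , ext , prime) = ℕ.≮⇒≥ λ q<k → ℕ.<⇒≱ (ℕ.^-monoʳ-< 2 (s≤s (s≤s z≤n)) q<k)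
    (subst (_≤ 2 ^ q) size (twins-bound G H ext prime M (uniform-twins G mod uni)))

  isolated-lower : ∀ {k q} → IsoSize G (2 ^ k) → HasPrimeExtension G q → k < q
  isolated-lower {k} {q} (S , iso , size) (H , ext , prime) = ℕ.≰⇒> λ q≤k → ℕ.<⇒≱
    (subst (_< 2 ^ q) size (isolated-bound G H ext prime S (λ {x} {y} x∈ y∈ z _ _ →
      trans (sym G z x) (trans (proj₁ (iso x) x∈ z) (≡.sym (trans (sym G z y) (proj₁ (iso y) y∈ z))))) λ {x} → proj₁ (iso x)))
    (ℕ.^-monoʳ-≤ 2 q≤k)

-- Combining the bounds.

double-complement : ∀ {n} (G : Graph n) x y → adj (complement (complement G)) x y ≡ adj G x y
double-complement G x y with x ≟ y
... | yes refl = ≡.sym (irrefl G x)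
... | no _ = not-involutive _

theorem4 : ∀ {n} (G : Graph n) (k : ℕ) → 1 ≤ k → MG G (2 ^ k) →
    (PrimeBound G (suc k) ⇔ (IsoSize G (2 ^ k) ⊎ IsoSize (complement G) (2 ^ k)))
    × (¬ (IsoSize G (2 ^ k) ⊎ IsoSize (complement G) (2 ^ k)) → PrimeBound G k)
theorem4 {n} G k 1≤k (a , w , ((A , (modA , stabA) , sizeA) , maxA) , ((W , (modW , cliqueW) , sizeW) , maxW) , a⊔w≡) =
  -- If both counts differ from `2 ^ k`, a prime `k`-extension contradicts the minimality of
  -- `suc k`; decidability turns this into the disjunction.
  mk⇔ (λ { (_ , least) → decidable-stable (isoSize? G (2 ^ k) ⊎-dec isoSize? Ḡ (2 ^ k)) λ none → least k ℕ.≤-refl (sharp none) })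
      (λ iso → large iso , λ q q<sk hpe → ℕ.<⇒≱ (strict iso hpe) (ℕ.≤-pred q<sk)) ,
  λ none → sharp none , λ q q<k hpe → ℕ.<⇒≱ q<k (lower hpe)
  where
  Ḡ : Graph n
  Ḡ = complement G

  opp : Opposite G Ḡ
  opp = complement-opposite G

  opp' : Opposite Ḡ G
  opp' = opposite-sym opp

  bound : Bounded G (2 ^ k)
  bound M mod (inj₁ clique) = ℕ.≤-trans (maxW M (mod , clique)) (subst (w ≤_) a⊔w≡ (ℕ.m≤n⊔m a w))
  bound M mod (inj₂ stable) = ℕ.≤-trans (maxA M (mod , stable)) (subst (a ≤_) a⊔w≡ (ℕ.m≤m⊔n a w))

  bound' : Bounded Ḡ (2 ^ k)
  bound' = opposite-bounded opp bound

  extremal : ∃ λ M → IsModule G M × Uniform G M × ∣ M ∣ ≡ 2 ^ k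
  extremal with ℕ.⊔-sel a w
  ... | inj₁ eq = A , modA , inj₂ stabA , trans sizeA (trans (≡.sym eq) a⊔w≡)
  ... | inj₂ eq = W , modW , inj₁ cliqueW , trans sizeW (trans (≡.sym eq) a⊔w≡)

  lower : ∀ {q} → HasPrimeExtension G q → k ≤ q
  lower with M , mod , uni , size ← extremal = uniform-lower G mod uni size

  sharp : ¬ (IsoSize G (2 ^ k) ⊎ IsoSize Ḡ (2 ^ k)) → HasPrimeExtension G k
  sharp none with extremal
  ... | M , mod , inj₂ stable , size = stable-extension G k 1≤k bound mod stable size (none ∘ inj₁) (none ∘ inj₂)
  -- A clique module becomes stable in the complement, where the two hypotheses on isolated vertices
  -- exchange roles.
  ... | M , mod , inj₁ clique , size = opposite-extension opp' (stable-extension Ḡ k 1≤k bound'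
    (opposite-module opp mod) (opposite-clique opp clique) size (none ∘ inj₂)
    (none ∘ inj₁ ∘ isoSize-cong (complement Ḡ) G (double-complement G)))

  large : IsoSize G (2 ^ k) ⊎ IsoSize Ḡ (2 ^ k) → HasPrimeExtension G (suc k)
  large (inj₁ iso) = isolated-extension G k 1≤k bound iso
  large (inj₂ iso) = opposite-extension opp' (isolated-extension Ḡ k 1≤k bound' iso)

  strict : IsoSize G (2 ^ k) ⊎ IsoSize Ḡ (2 ^ k) → ∀ {q} → HasPrimeExtension G q → k < q
  strict (inj₁ iso) hpe = isolated-lower G iso hpe
  strict (inj₂ iso) hpe = isolated-lower Ḡ iso (opposite-extension opp hpe)
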